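{- The acyclic maps are stable under pullbacks and pushouts. That is: if $f : B \to C$ is acyclic and $g : A \to C$ is any map, then the projection $A \times_C B \to A$ is acyclic; and if $f : A \to B$ is acyclic and $g : A \to C$ is any map, then the pushout inclusion $\mathrm{inr} : C \to B +_A C$ is acyclic.
   Context: We work in homotopy type theory (HoTT) in the style of the HoTT Book: dependent type theory with univalent universes (hence function extensionality) and higher inductive types such as pushouts; no classical axioms are assumed. The suspension $\Sigma A$ of a type $A$ is the pushout of $\mathbf{1} \leftarrow A \to \mathbf{1}$. A type is acyclic if its suspension is contractible; a map is acyclic if all its fibers are acyclic types. -}

{-# OPTIONS --without-K #-}
module Defs where

open import Level using (_⊔_; Setω)
open import Data.Product using (Σ-syntax)
open import Data.Unit using (⊤; tt)
open import Relation.Binary.PropositionalEquality using (_≡_; trans; cong; subst; dcong)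

-- Plain Agda has no higher inductive types, so the homotopy pushout is
-- specified by its introduction, dependent elimination and computation rules,
-- with elimination into all universes.  The computation rules are only
-- propositional, also on points; this is why `ind-glue` corrects the action of
-- `ind` on `glue x` at its two ends by `ind-inl` and `ind-inr`.
record IsPushout {a b c} {A : Set a} {B : Set b} {C : Set c}
                 (f : A → B) (g : A → C) (P : Set (a ⊔ b ⊔ c)) : Setω where
  field
    inl  : B → P
    inr  : C → P
    glue : ∀ x → inl (f x) ≡ inr (g x)

    ind : ∀ {q} (Q : P → Set q)
          (l : ∀ y → Q (inl y)) (r : ∀ z → Q (inr z)) →
          (∀ x → subst Q (glue x) (l (f x)) ≡ r (g x)) →
          ∀ w → Q w

    ind-inl : ∀ {q} (Q : P → Set q)
              (l : ∀ y → Q (inl y)) (r : ∀ z → Q (inr z))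
              (h : ∀ x → subst Q (glue x) (l (f x)) ≡ r (g x)) →
              ∀ y → ind Q l r h (inl y) ≡ l y

    ind-inr : ∀ {q} (Q : P → Set q)
              (l : ∀ y → Q (inl y)) (r : ∀ z → Q (inr z))
              (h : ∀ x → subst Q (glue x) (l (f x)) ≡ r (g x)) →
              ∀ z → ind Q l r h (inr z) ≡ r z

    ind-glue : ∀ {q} (Q : P → Set q)
               (l : ∀ y → Q (inl y)) (r : ∀ z → Q (inr z))
               (h : ∀ x → subst Q (glue x) (l (f x)) ≡ r (g x)) →
               ∀ x →
               trans (dcong (ind Q l r h) (glue x)) (ind-inr Q l r h (g x))
               ≡ trans (cong (subst Q (glue x)) (ind-inl Q l r h (f x))) (h x)

-- A choice of pushout B +_A C for every span; a theorem about homotopy type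
-- theory with pushouts takes an arbitrary such choice as a hypothesis.
record Pushouts : Setω where
  field
    Pushout   : ∀ {a b c} {A : Set a} {B : Set b} {C : Set c} →
                (A → B) → (A → C) → Set (a ⊔ b ⊔ c)
    isPushout : ∀ {a b c} {A : Set a} {B : Set b} {C : Set c}
                (f : A → B) (g : A → C) → IsPushout f g (Pushout f g)

  module _ {a b c} {A : Set a} {B : Set b} {C : Set c} (f : A → B) (g : A → C) where
    open IsPushout (isPushout f g) public

isContr : ∀ {a} → Set a → Set a
isContr A = Σ[ x ∈ A ] (∀ y → x ≡ y)

fiber : ∀ {a b} {A : Set a} {B : Set b} → (A → B) → B → Set (a ⊔ b)
fiber {A = A} f y = Σ[ x ∈ A ] f x ≡ y

-- The homotopy pullback A ×_C B; `proj₁` is the projection to A.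
Pullback : ∀ {a b c} {A : Set a} {B : Set b} {C : Set c} →
           (A → C) → (B → C) → Set (a ⊔ b ⊔ c)
Pullback {A = A} {B = B} g f = Σ[ x ∈ A ] Σ[ y ∈ B ] g x ≡ f y

module Acyclicity (po : Pushouts) where
  open Pushouts po

  Suspension : ∀ {a} → Set a → Set a
  Suspension A = Pushout {A = A} {B = ⊤} {C = ⊤} (λ _ → tt) (λ _ → tt)

  isAcyclic : ∀ {a} → Set a → Set a
  isAcyclic A = isContr (Suspension A)

  isAcyclicMap : ∀ {a b} {A : Set a} {B : Set b} → (A → B) → Set (a ⊔ b)
  isAcyclicMap {B = B} f = (y : B) → isAcyclic (fiber f y)

{-# OPTIONS --without-K #-}

-- Acyclic maps are the maps f along which pointwise homotopies between dependent
-- functions extend.  In one direction, a map F → (u ≡ v) is the same as a map out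
-- of the suspension of F, so it is constant if F is acyclic.  In the other, it is
-- enough to extend the meridians, a homotopy along f between the two poles of the
-- suspensions of the fibers.  The extension property passes to pushouts by
-- induction on the pushout.
module Submission where

open import Level using (Level; _⊔_; suc)
open import Data.Product using (_×_; proj₁; proj₂; _,_; Σ-syntax)
open import Data.Unit using (tt)
open import Axiom.Extensionality.Propositional using (Extensionality)
open import Relation.Binary.PropositionalEquality
  using (_≡_; refl; sym; trans; cong; subst; dcong; trans-symˡ; subst-subst-sym)
open import Defs

private variable
  a b c q : Level
  A : Set a
  B : Set b
  C : Set c

-- A pointwise form of `f` being an epimorphism for dependent functions. The level `q` is explicit
-- because the converse below takes it at the level of the suspended fibers.
ExtendsHomotopies : (q : Level) {A : Set a} {B : Set b} → (A → B) → Set (a ⊔ b ⊔ suc q)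
ExtendsHomotopies q {A} {B} f =
  (Q : B → Set q) (s t : ∀ y → Q y) (H : ∀ x → s (f x) ≡ t (f x)) →
  Σ[ p ∈ (∀ y → s y ≡ t y) ] (∀ x → p (f x) ≡ H x)

isContr→path : isContr A → (x y : A) → x ≡ y
isContr→path (_ , contr) x y = trans (sym (contr x)) (contr y)

isContr→path-unique : (A-contr : isContr A) {x y : A} (e : x ≡ y) →
                      isContr→path A-contr x y ≡ e
isContr→path-unique (_ , contr) refl = trans-symˡ (contr _)

sym-involutive : {x y : A} (e : x ≡ y) → sym (sym e) ≡ e
sym-involutive refl = refl

subst-constant : {x y : A} (e : x ≡ y) (u : B) → subst (λ _ → B) e u ≡ u
subst-constant refl u = refl

subst-based-path : {x y : A} (e : x ≡ y) → subst (x ≡_) e refl ≡ e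
subst-based-path refl = refl

-- Turns `ind-glue` for a constant family into a rule for `cong`, with `α` and `β` as corrections at
-- the endpoints.
dcong→cong : (φ : A → B) {x y : A} (e : x ≡ y) {u v : B}
             (α : φ x ≡ u) (β : φ y ≡ v) (h : u ≡ v) →
             trans (dcong φ e) β
               ≡ trans (cong (subst (λ _ → B) e) α) (trans (subst-constant e u) h) →
             trans (sym α) (trans (cong φ e) β) ≡ h
dcong→cong φ refl refl β h eq = eq

-- `H` is moved back along `glue` to the points `f x` and extended over `B`. That the extension
-- restricts to it is the coherence which induction requires at `glue`.
inr-extendsHomotopies : {f : A → B} {g : A → C} {P : Set _} (isPO : IsPushout f g P) →
                        ExtendsHomotopies q f →
                        ExtendsHomotopies q (IsPushout.inr isPO)
inr-extendsHomotopies {f = f} {g = g} isPO f-ext Q s t H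
  with f-ext (λ y → Q (inl y)) (λ y → s (inl y)) (λ y → t (inl y))
             (λ x → subst (λ w → s w ≡ t w) (sym (glue x)) (H (g x)))
  where open IsPushout isPO
... | p , p-f = ind E p H coherence , ind-inr E p H coherence
  where
  open IsPushout isPO
  E = λ w → s w ≡ t w
  coherence : ∀ x → subst E (glue x) (p (f x)) ≡ H (g x)
  coherence x = trans (cong (subst E (glue x)) (p-f x)) (subst-subst-sym (glue x))

module _ (po : Pushouts) where
  open Pushouts po
  open Acyclicity po

  -- In a contractible suspension all meridians equal one path between the poles. Up to corrections
  -- at the poles, `φ` takes the meridian of `x` to `H x`, so the image of that one path serves
  -- every `x`.
  isAcyclic→paths-constant : isAcyclic A → {u v : B} (H : A → u ≡ v) →
                             Σ[ p ∈ u ≡ v ] (∀ x → p ≡ H x)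
  isAcyclic→paths-constant {A = A} {B = B} A-acyclic {u} {v} H =
    path pole-path , λ x →
      trans (cong path (isContr→path-unique A-acyclic (merid x)))
            (dcong→cong φ (merid x) φ-north φ-south (H x)
               (S.ind-glue (λ _ → B) (λ _ → u) (λ _ → v) h x))
    where
    module S = IsPushout (isPushout {A = A} (λ _ → tt) (λ _ → tt))
    merid = S.glue
    h : ∀ x → subst (λ _ → B) (merid x) u ≡ v
    h x = trans (subst-constant (merid x) u) (H x)
    φ = S.ind (λ _ → B) (λ _ → u) (λ _ → v) h
    φ-north = S.ind-inl (λ _ → B) (λ _ → u) (λ _ → v) h tt
    φ-south = S.ind-inr (λ _ → B) (λ _ → u) (λ _ → v) h tt
    pole-path = isContr→path A-acyclic (S.inl tt) (S.inr tt)
    path : S.inl tt ≡ S.inr tt → u ≡ v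
    path e = trans (sym φ-north) (trans (cong φ e) φ-south)

  isAcyclicMap→extendsHomotopies : (f : A → B) → isAcyclicMap f → ExtendsHomotopies q f
  isAcyclicMap→extendsHomotopies f f-acyclic Q s t H =
    -- At `(x , refl)`, `on-fiber` reduces to `H x`.
    (λ y → proj₁ (extension y)) , λ x → proj₂ (extension (f x)) (x , refl)
    where
    on-fiber : ∀ y → fiber f y → s y ≡ t y
    on-fiber _ (x , refl) = H x
    extension : ∀ y → Σ[ p ∈ s y ≡ t y ] (∀ z → p ≡ on-fiber y z)
    extension y = isAcyclic→paths-constant (f-acyclic y) (on-fiber y)

  extendsHomotopies→isAcyclicMap : {A : Set a} {B : Set b} (f : A → B) →
                                   ExtendsHomotopies (a ⊔ b) f → isAcyclicMap f
  extendsHomotopies→isAcyclicMap f f-ext y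
    with f-ext (λ y → Suspension (fiber f y)) (λ _ → inl _ _ tt) (λ _ → inr _ _ tt)
               (λ x → glue _ _ (x , refl))
  ... | p , p-f =
    -- The suspension contracts to its north pole; `p y` reaches the south pole and agrees with
    -- every meridian.
    inl _ _ tt , ind _ _ (inl _ _ tt ≡_) (λ _ → refl) (λ _ → p y) (meridian y)
    where
    -- General in `y`, so that the path in `z` can be matched with `refl`.
    meridian : ∀ y (z : fiber f y) → subst (inl _ _ tt ≡_) (glue _ _ z) refl ≡ p y
    meridian _ (x , refl) = trans (subst-based-path (glue _ _ (x , refl))) (sym (p-f x))

  -- The fiber of the projection over `x` is the fiber of `f` over `g x` with its path inverted;
  -- hence `sym`, and `sym-involutive` for the round trip.
  pullback-isAcyclicMap : (f : B → C) (g : A → C) → isAcyclicMap f →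
                          isAcyclicMap {A = Pullback g f} {B = A} proj₁
  pullback-isAcyclicMap f g f-acyclic =
    extendsHomotopies→isAcyclicMap proj₁ λ Q s t H →
      let on-fiber : ∀ x → fiber f (g x) → s x ≡ t x
          on-fiber x (y , e) = H (x , y , sym e)
          extension x = isAcyclic→paths-constant (f-acyclic (g x)) (on-fiber x)
      in (λ x → proj₁ (extension x)) ,
         λ (x , y , e) → trans (proj₂ (extension x) (y , sym e))
                               (cong (λ e′ → H (x , y , e′)) (sym-involutive e))

  pushout-isAcyclicMap : (f : A → B) (g : A → C) → isAcyclicMap f →
                         isAcyclicMap {A = C} {B = Pushout f g} (inr f g)
  pushout-isAcyclicMap f g f-acyclic =
    extendsHomotopies→isAcyclicMap (inr f g)
      (inr-extendsHomotopies (isPushout f g) (isAcyclicMap→extendsHomotopies f f-acyclic))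

proposition2p15 :
    (funext : ∀ {a b} → Extensionality a b) (po : Pushouts) →
    let open Pushouts po
        open Acyclicity po
    in
    ∀ {a b c} {A : Set a} {B : Set b} {C : Set c} →
      ((f : B → C) (g : A → C) → isAcyclicMap f →
        isAcyclicMap {A = Pullback g f} {B = A} proj₁)
      ×
      ((f : A → B) (g : A → C) → isAcyclicMap f →
        isAcyclicMap {A = C} {B = Pushout f g} (inr f g))
proposition2p15 funext po = pullback-isAcyclicMap po , pushout-isAcyclicMap po
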